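{- Let $v$ be a vertex of tenacity $t\le l_m$ and let $p$ be a $\mathrm{maxlevel}(v)$ path. Then $p$ contains exactly one bridge of tenacity $t$.
   Context: $G=(V,E)$ is a finite undirected graph with a matching $M$, with at least one unmatched vertex. Alternating paths are simple paths alternating between unmatched edges (not in $M$) and matched edges (in $M$), starting with an unmatched edge when starting at an unmatched vertex. $l_m$ is the minimum length of an augmenting path (alternating path between two distinct unmatched vertices), $\infty$ if none. $\mathrm{evenlevel}(v)$, $\mathrm{oddlevel}(v)$ are the minimum lengths of even, resp. odd, alternating paths from an unmatched vertex to $v$ ($\infty$ if none); such minimum paths are $\mathrm{evenlevel}(v)$, $\mathrm{oddlevel}(v)$ paths. $\mathrm{minlevel}(v)$ and $\mathrm{maxlevel}(v)$ are the smaller and larger of the two; a $\mathrm{minlevel}(v)$ (resp. $\mathrm{maxlevel}(v)$) path is an $\mathrm{evenlevel}(v)$ or $\mathrm{oddlevel}(v)$ path of length $\mathrm{minlevel}(v)$ (resp. $\mathrm{maxlevel}(v)$). Tenacity of a vertex: $t(v)=\mathrm{evenlevel}(v)+\mathrm{oddlevel}(v)$; of an unmatched edge $(u,v)$: $\mathrm{evenlevel}(u)+\mathrm{evenlevel}(v)+1$; of a matched edge $(u,v)$: $\mathrm{oddlevel}(u)+\mathrm{oddlevel}(v)+1$. An edge $(u,v)$ is a prop if it is the last edge of some $\mathrm{minlevel}(v)$ path (or, symmetrically, of some $\mathrm{minlevel}(u)$ path); an edge that is not a prop is a bridge. -}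

module Defs where

open import Data.Nat using (ℕ; zero; suc; _+_; _≤_; _%_)
import Data.Nat as N
open import Data.Fin using (Fin; zero; suc; inject₁; fromℕ; toℕ)
open import Data.Product using (Σ; ∃; _×_; _,_)
open import Data.Empty using (⊥)
open import Data.Sum using (_⊎_)
open import Data.Unit using (⊤)
open import Relation.Nullary using (¬_)
open import Relation.Binary.PropositionalEquality using (_≡_; _≢_)

data ℕ∞ : Set where
  fin : ℕ → ℕ∞
  ∞   : ℕ∞

infixl 6 _+∞_
_+∞_ : ℕ∞ → ℕ∞ → ℕ∞
fin m +∞ fin n = fin (m + n)
_     +∞ _     = ∞

infix 4 _≤∞_
_≤∞_ : ℕ∞ → ℕ∞ → Set
fin m ≤∞ fin n = m ≤ n
fin m ≤∞ ∞     = ⊤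
∞     ≤∞ fin n = ⊥
∞     ≤∞ ∞     = ⊤

max∞ : ℕ∞ → ℕ∞ → ℕ∞
max∞ (fin m) (fin n) = fin (m N.⊔ n)
max∞ _       _       = ∞

min∞ : ℕ∞ → ℕ∞ → ℕ∞
min∞ (fin m) (fin n) = fin (m N.⊓ n)
min∞ (fin m) ∞       = fin m
min∞ ∞       y       = y

IsMin : (ℕ → Set) → ℕ∞ → Set
IsMin P (fin k) = P k × (∀ k′ → P k′ → k ≤ k′)
IsMin P ∞       = ∀ k → ¬ P k

Even Odd : ℕ → Set
Even k = k % 2 ≡ 0
Odd  k = k % 2 ≡ 1

record MGraph : Set₁ where
  field
    n      : ℕ
    E      : Fin n → Fin n → Set
    E-sym  : ∀ {u v} → E u v → E v u
    E-irr  : ∀ {u} → ¬ E u u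
    M      : Fin n → Fin n → Set
    M⊆E    : ∀ {u v} → M u v → E u v
    M-sym  : ∀ {u v} → M u v → M v u
    M-uniq : ∀ {u v w} → M u v → M u w → v ≡ w

module _ (G : MGraph) where
  open MGraph G

  V : Set
  V = Fin n

  Unmatched : V → Set
  Unmatched v = ∀ w → ¬ M v w

  record AltPath (k : ℕ) : Set where
    field
      vert   : Fin (suc k) → V
      simple : ∀ i j → vert i ≡ vert j → i ≡ j
      start  : Unmatched (vert zero)
      edge   : ∀ (i : Fin k) → E (vert (inject₁ i)) (vert (suc i))
      alt-ev : ∀ (i : Fin k) → Even (toℕ i) → ¬ M (vert (inject₁ i)) (vert (suc i))
      alt-od : ∀ (i : Fin k) → Odd (toℕ i) → M (vert (inject₁ i)) (vert (suc i))

  open AltPath public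

  endV : ∀ {k} → AltPath k → V
  endV {k} p = vert p (fromℕ k)

  EvenLen OddLen : V → ℕ → Set
  EvenLen v k = Even k × Σ (AltPath k) λ p → endV p ≡ v
  OddLen  v k = Odd k × Σ (AltPath k) λ p → endV p ≡ v

  AugLen : ℕ → Set
  AugLen k = Σ (AltPath k) λ p → Unmatched (endV p) × vert p zero ≢ endV p

  record Levels : Set where
    field
      evenlevel   : V → ℕ∞
      oddlevel    : V → ℕ∞
      lm          : ℕ∞
      evenlevel-spec : ∀ v → IsMin (EvenLen v) (evenlevel v)
      oddlevel-spec  : ∀ v → IsMin (OddLen v) (oddlevel v)
      lm-spec        : IsMin AugLen lm

  module _ (L : Levels) where
    open Levels L

    minlevel maxlevel tenacity : V → ℕ∞
    minlevel v = min∞ (evenlevel v) (oddlevel v)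
    maxlevel v = max∞ (evenlevel v) (oddlevel v)
    tenacity v = evenlevel v +∞ oddlevel v

    EdgeTenacity : V → V → ℕ∞ → Set
    EdgeTenacity u w t =
      (¬ M u w → t ≡ evenlevel u +∞ evenlevel w +∞ fin 1) ×
      (M u w → t ≡ oddlevel u +∞ oddlevel w +∞ fin 1)

    LastOfMinPath : V → V → Set
    LastOfMinPath u w =
      Σ ℕ λ k → Σ (AltPath (suc k)) λ p →
        (endV p ≡ w) × (vert p (inject₁ (fromℕ k)) ≡ u) × (fin (suc k) ≡ minlevel w)

    Prop : V → V → Set
    Prop u w = LastOfMinPath u w ⊎ LastOfMinPath w u

    Bridge : V → V → Set
    Bridge u w = E u w × ¬ Prop u w

    BridgeOfTenacityAt : ∀ {k} → AltPath k → Fin k → ℕ∞ → Set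
    BridgeOfTenacityAt p i t =
      Bridge (vert p (inject₁ i)) (vert p (suc i)) ×
      EdgeTenacity (vert p (inject₁ i)) (vert p (suc i)) t

{-# OPTIONS --safe #-}
module Submission where

-- A walk that follows one alternating path up to its first meeting with another, and then runs along
-- the latter, is simple, and it alternates in exactly one of the two directions, by parity. Let p be a
-- shortest path of its parity to v. Applied to p, the meeting argument shows that a vertex on p at
-- distance i is either at its minlevel i, or its level of the opposite parity is at most t(v) - i.
-- Hence vertices of tenacity at least t(v) sit on p at their level, and those of larger tenacity at
-- their minlevel.
--
-- For a threshold τ ≤ l_m call a vertex high if its tenacity is at least τ; unmatched vertices are high.
-- By induction on τ, all shortest paths of both parities to a low vertex have the same last high
-- vertex, the base, and the ends of an edge of tenacity below τ have the same base.
--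
-- Now let τ = t(v) = t and let p be a maxlevel(v) path. Let b be the first high index of p that is not
-- at its minlevel, a the last high index before b, and c the last index in [a, b) that p visits at its
-- level. Up to c the base is p a, strictly between c and b it is p b, so the edge from c to c + 1 has
-- tenacity t, and it is the only bridge of that tenacity.

open import Defs
open import Data.Bool using (Bool; true; false; not; _xor_)
import Data.Bool.Properties as Bool
open import Data.Empty using (⊥; ⊥-elim)
open import Data.Nat using (ℕ; zero; suc; _+_; _∸_; _⊓_; _≤_; _<_; z≤n; s≤s; _≤?_; _<?_)
import Data.Nat as Nat
open import Data.Fin using (Fin; zero; suc; toℕ; fromℕ; fromℕ<; inject₁)
import Data.Fin.Properties as Fin
open import Data.Nat.Induction using (<-rec)
open import Data.Nat.Properties hiding (_≟_)
open import Data.Product using (Σ; ∃; ∃₂; _×_; _,_; proj₁; proj₂)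
open import Data.Sum using (_⊎_; inj₁; inj₂)
open import Function using (_∘_)
open import Relation.Binary.Definitions using (DecidableEquality; tri<; tri≈; tri>)
open import Relation.Binary.PropositionalEquality using (_≡_; _≢_; refl; sym; trans; cong; cong₂; subst; subst₂)
open import Relation.Nullary using (¬_; Dec; yes; no)
open import Relation.Nullary.Decidable using (_×-dec_)
open import Relation.Unary using (Decidable)

-- Parity and bounded search

par : ℕ → Bool
par zero    = false
par (suc k) = not (par k)

par-+ : ∀ a b → par (a + b) ≡ par a xor par b
par-+ zero    b = refl
par-+ (suc a) b = trans (cong not (par-+ a b)) (Bool.not-distribˡ-xor (par a) (par b))

par-+ʳ : ∀ {a b} c → par a ≡ par b → par (a + c) ≡ par (b + c)
par-+ʳ {a} {b} c eq = trans (par-+ a c) (trans (cong (_xor par c) eq) (sym (par-+ b c)))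

-- For walks that turn back: retracing `c` edges flips the parity as often as advancing by `c`.
par-shift : ∀ a b c → par a ≡ par (b + c) → par (a + c) ≡ par b
par-shift a b zero    eq rewrite +-identityʳ a | +-identityʳ b = eq
par-shift a b (suc c) eq rewrite +-suc a c | +-suc b c =
  trans (cong not (par-shift a (suc b) c eq)) (Bool.not-involutive (par b))

same-or-not : ∀ a b → a ≡ b ⊎ a ≡ not b
same-or-not a b with a Bool.≟ b
... | yes eq = inj₁ eq
... | no  ne = inj₂ (Bool.¬-not ne)

first : ∀ {P : ℕ → Set} → Decidable P → ∀ n →
        (∃ λ m → m ≤ n × P m × (∀ {y} → y < m → ¬ P y)) ⊎ (∀ {y} → y ≤ n → ¬ P y)
first P? zero with P? zero
... | yes P0 = inj₁ (zero , z≤n , P0 , λ ())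
... | no ¬P0 = inj₂ λ { z≤n → ¬P0 }
first P? (suc n) with first P? n
... | inj₁ (m , m≤n , Pm , below) = inj₁ (m , m≤n⇒m≤1+n m≤n , Pm , below)
... | inj₂ none with P? (suc n)
...   | yes Pn = inj₁ (suc n , ≤-refl , Pn , λ y<m → none (≤-pred y<m))
...   | no ¬Pn = inj₂ λ y≤m Py → case-≤ y≤m Py
  where
  case-≤ : ∀ {y} → y ≤ suc n → ¬ _
  case-≤ y≤m Py with m≤n⇒m<n∨m≡n y≤m
  ... | inj₁ y<m  = none (≤-pred y<m) Py
  ... | inj₂ refl = ¬Pn Py

last : ∀ {P : ℕ → Set} → Decidable P → ∀ n {a} → a ≤ n → P a →
       ∃ λ m → a ≤ m × m ≤ n × P m × (∀ {y} → m < y → y ≤ n → ¬ P y)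
last P? zero z≤n Pa = zero , z≤n , z≤n , Pa , λ m<y y≤n → ⊥-elim (<⇒≱ m<y y≤n)
last P? (suc n) a≤n Pa with P? (suc n)
... | yes Pn = suc n , a≤n , ≤-refl , Pn , λ m<y y≤n → ⊥-elim (<⇒≱ m<y y≤n)
... | no ¬Pn with m≤n⇒m<n∨m≡n a≤n
...   | inj₂ refl = ⊥-elim (¬Pn Pa)
...   | inj₁ a<n with last P? n (≤-pred a<n) Pa
...     | m , a≤m , m≤n , Pm , above = m , a≤m , m≤n⇒m≤1+n m≤n , Pm , above′
  where
  above′ : ∀ {y} → m < y → y ≤ suc n → ¬ _
  above′ m<y y≤n with m≤n⇒m<n∨m≡n y≤n
  ... | inj₁ y<n  = above m<y (≤-pred y<n)
  ... | inj₂ refl = ¬Pn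

split : ∀ i len d → i ≤ len + d → i < len ⊎ (∃ λ y → i ≡ len + y × y ≤ d)
split i len d i≤ with i <? len
... | yes i<len = inj₁ i<len
... | no i≮len with m≤n⇒∃[o]m+o≡n (≮⇒≥ i≮len)
...   | y , refl = inj₂ (y , refl , +-cancelˡ-≤ len y d i≤)

-- Alternating paths and their concatenation

module Paths
  (V : Set) (_≟_ : DecidableEquality V)
  (Ed : Bool → V → V → Set) (Ed-sym : ∀ {b u w} → Ed b u w → Ed b w u)
  (Free : V → Set)
  where

  join : (ℕ → V) → ℕ → (ℕ → V) → ℕ → V
  join s zero      g x       = g x
  join s (suc len) g zero    = s zero
  join s (suc len) g (suc x) = join (s ∘ suc) len g x

  join-≤ : ∀ s len g → s len ≡ g 0 → ∀ {x} → x ≤ len → join s len g x ≡ s x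
  join-≤ s zero      g eq z≤n       = sym eq
  join-≤ s (suc len) g eq z≤n       = refl
  join-≤ s (suc len) g eq (s≤s x≤l) = join-≤ (s ∘ suc) len g eq x≤l

  join-+ : ∀ s len g y → join s len g (len + y) ≡ g y
  join-+ s zero      g y = refl
  join-+ s (suc len) g y = join-+ (s ∘ suc) len g y

  -- A path of length k is a function on ℕ whose values beyond k are junk, so that prefixes come for free.
  -- Ed false and Ed true are the unmatched and the matched edges.
  record Path (p : ℕ → V) (k : ℕ) : Set where
    field
      inj  : ∀ {i j} → i ≤ k → j ≤ k → p i ≡ p j → i ≡ j
      free : Free (p 0)
      step : ∀ {i} → i < k → Ed (par i) (p i) (p (suc i))

  open Path public

  prefix : ∀ {p k i} → Path p k → i ≤ k → Path p i
  prefix P i≤k .inj a b = P .inj (≤-trans a i≤k) (≤-trans b i≤k)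
  prefix P i≤k .free    = P .free
  prefix P i≤k .step a  = P .step (≤-trans a i≤k)

  join-path : ∀ {s len g d} → Path s len → s len ≡ g 0 →
    (∀ {i j} → i ≤ d → j ≤ d → g i ≡ g j → i ≡ j) →
    (∀ {y} → y < d → Ed (par (len + y)) (g y) (g (suc y))) →
    (∀ {x y} → x < len → y ≤ d → s x ≢ g y) →
    Path (join s len g) (len + d)
  join-path {s} {len} {g} {d} S eq g-inj g-step disj = record
    { inj = inj′ ; free = subst Free (sym (before z≤n)) (S .free) ; step = step′ }
    where
    before : ∀ {x} → x ≤ len → join s len g x ≡ s x
    before = join-≤ s len g eq
    inj′ : ∀ {i j} → i ≤ len + d → j ≤ len + d → join s len g i ≡ join s len g j → i ≡ j
    inj′ {i} {j} i≤ j≤ e with split i len d i≤ | split j len d j≤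
    ... | inj₁ i< | inj₁ j< = S .inj (<⇒≤ i<) (<⇒≤ j<) (trans (sym (before (<⇒≤ i<))) (trans e (before (<⇒≤ j<))))
    ... | inj₁ i< | inj₂ (y , refl , y≤) = ⊥-elim (disj i< y≤ (trans (sym (before (<⇒≤ i<))) (trans e (join-+ s len g y))))
    ... | inj₂ (y , refl , y≤) | inj₁ j< = ⊥-elim (disj j< y≤ (trans (sym (before (<⇒≤ j<))) (trans (sym e) (join-+ s len g y))))
    ... | inj₂ (y , refl , y≤) | inj₂ (z , refl , z≤) =
      cong (len +_) (g-inj y≤ z≤ (trans (sym (join-+ s len g y)) (trans e (join-+ s len g z))))
    step′ : ∀ {i} → i < len + d → Ed (par i) (join s len g i) (join s len g (suc i))
    step′ {i} i< with split i len d (<⇒≤ i<)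
    ... | inj₁ i<len = subst₂ (Ed (par i)) (sym (before (<⇒≤ i<len))) (sym (before i<len)) (S .step i<len)
    ... | inj₂ (y , refl , _) = subst₂ (Ed (par (len + y))) (sym (join-+ s len g y))
      (sym (trans (cong (join s len g) (sym (+-suc len y))) (join-+ s len g (suc y))))
      (g-step (+-cancelˡ-< len y d i<))

  snoc : (ℕ → V) → ℕ → V → ℕ → V
  snoc p k v = join p k λ { zero → p k ; (suc _) → v }

  snoc-≤ : ∀ p k v {x} → x ≤ k → snoc p k v x ≡ p x
  snoc-≤ p k v = join-≤ p k _ refl

  snoc-end : ∀ p k v → snoc p k v (k + 1) ≡ v
  snoc-end p k v = join-+ p k _ 1

  snoc-path : ∀ {p k v} → Path p k → Ed (par k) (p k) v → (∀ {x} → x ≤ k → p x ≢ v) →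
              Path (snoc p k v) (k + 1)
  snoc-path {p} {k} {v} P e new = join-path P refl
    (λ { {zero} {zero} _ _ _ → refl
       ; {zero} {suc zero} _ _ eq → ⊥-elim (new ≤-refl eq)
       ; {suc zero} {zero} _ _ eq → ⊥-elim (new ≤-refl (sym eq))
       ; {suc zero} {suc zero} _ _ _ → refl
       ; {suc (suc _)} (s≤s ()) _ _
       ; {_} {suc (suc _)} _ (s≤s ()) _ })
    (λ { {zero} _ → subst (λ b → Ed b (p k) v) (cong par (sym (+-identityʳ k))) e ; {suc _} (s≤s ()) })
    (λ { {x} {zero} x<k _ eq → <⇒≢ x<k (P .inj (<⇒≤ x<k) ≤-refl eq)
       ; {x} {suc _} x<k _ eq → new (<⇒≤ x<k) eq })

  forward-path : ∀ {p s} j d x → Path p (j + d) → Path s x → s x ≡ p j → par x ≡ par j →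
    (∀ {y z} → y < x → j ≤ z → z ≤ j + d → s y ≢ p z) →
    Path (join s x (λ y → p (j + y))) (x + d)
  forward-path {p} {s} j d x P S eq pr miss = join-path S
    (trans eq (cong p (sym (+-identityʳ j))))
    (λ {a} {b} a≤ b≤ e → +-cancelˡ-≡ j a b (P .inj (+-monoʳ-≤ j a≤) (+-monoʳ-≤ j b≤) e))
    (λ {y} y<d → subst₂ (λ b v → Ed b (p (j + y)) v) (sym (par-+ʳ {x} {j} y pr)) (cong p (sym (+-suc j y)))
      (P .step (+-monoʳ-< j y<d)))
    (λ {_} {y} a b → miss a (m≤m+n j y) (+-monoʳ-≤ j b))

  -- Having arrived at `p (i + d)` with the parity opposite to its index, `s` needs a next edge of
  -- the same kind as the one by which `p` enters that vertex, so it may follow `p` backwards.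
  backward-path : ∀ {p s} i d x → Path p (i + d) → Path s x → s x ≡ p (i + d) → par x ≡ not (par (i + d)) →
    (∀ {y z} → y < x → i ≤ z → z ≤ i + d → s y ≢ p z) →
    Path (join s x (λ y → p (i + (d ∸ y)))) (x + d)
  backward-path {p} {s} i d x P S eq pr miss = join-path S eq
    (λ {a} {b} a≤ b≤ e → ∸-cancelˡ-≡ a≤ b≤ (+-cancelˡ-≡ i _ _
      (P .inj (+-monoʳ-≤ i (m∸n≤m d a)) (+-monoʳ-≤ i (m∸n≤m d b)) e)))
    (λ {y} y<d → back-step y y<d)
    (λ {_} {y} a b → miss a (m≤m+n i (d ∸ y)) (+-monoʳ-≤ i (m∸n≤m d y)))
    where
    back-step : ∀ y → y < d → Ed (par (x + y)) (p (i + (d ∸ y))) (p (i + (d ∸ suc y)))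
    back-step y y<d = Ed-sym (subst₂ (λ b v → Ed b (p c) v) (sym (par-shift x c y par-c)) (cong p c-suc)
      (P .step (subst (c <_) c+ (m<m+n c (s≤s z≤n)))))
      where
      c : ℕ
      c = i + (d ∸ suc y)
      c+ : c + suc y ≡ i + d
      c+ = trans (+-assoc i _ _) (cong (i +_) (m∸n+n≡m y<d))
      c-suc : suc c ≡ i + (d ∸ y)
      c-suc = trans (sym (+-suc i _)) (cong (i +_) (sym (+-∸-assoc 1 y<d)))
      par-c : par x ≡ par (c + y)
      par-c = trans pr (trans (cong (not ∘ par) (trans (sym c+) (+-suc c y))) (Bool.not-involutive _))

  -- First meeting of two paths

  record Hit (s p : ℕ → V) (i k x j : ℕ) : Set where
    field
      i≤j  : i ≤ j
      j≤k  : j ≤ k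
      at   : s x ≡ p j
      miss : ∀ {y z} → y < x → i ≤ z → z ≤ k → s y ≢ p z

  occurs? : ∀ (v : V) (p : ℕ → V) i k → Dec (∃ λ z → z < suc k × (i ≤ z × v ≡ p z))
  occurs? v p i k = anyUpTo? (λ z → (i ≤? z) ×-dec (v ≟ p z)) (suc k)

  first-hit : ∀ (s p : ℕ → V) i k n → (∃₂ λ x j → x ≤ n × Hit s p i k x j) ⊎
                            (∀ {y z} → y ≤ n → i ≤ z → z ≤ k → s y ≢ p z)
  first-hit s p i k n with first (λ y → occurs? (s y) p i k) n
  ... | inj₂ none = inj₂ λ y≤n i≤z z≤k e → none y≤n (_ , s≤s z≤k , i≤z , e)
  ... | inj₁ (x , x≤n , (j , s≤s j≤k , i≤j , e) , below) = inj₁ (x , j , x≤n ,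
    record { i≤j = i≤j ; j≤k = j≤k ; at = e ; miss = λ y<x i≤z z≤k e′ → below y<x (_ , s≤s z≤k , i≤z , e′) })

  on-path? : ∀ (p : ℕ → V) k v → (∃ λ x → x ≤ k × p x ≡ v) ⊎ (∀ {x} → x ≤ k → p x ≢ v)
  on-path? p k v with first (λ x → p x ≟ v) k
  ... | inj₁ (x , x≤k , e , _) = inj₁ (x , x≤k , e)
  ... | inj₂ none = inj₂ none

  -- ℓ b v is the level of v of parity b, with N in place of ∞; N exceeds every tenacity that matters.
  module Levelled
    (ℓ : Bool → V → ℕ) (N t : ℕ) (t<N : t < N)
    (ℓ-min : ∀ {p k} → Path p k → ℓ (par k) (p k) ≤ k)
    (ℓ-path : ∀ b v → ℓ b v < N → Σ (ℕ → V) λ p → Path p (ℓ b v) × p (ℓ b v) ≡ v × par (ℓ b v) ≡ b)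
    (free-high : ∀ {v} → Free v → t ≤ ℓ false v + ℓ true v)
    where

    -- Tenacity, minlevel and the two levels along a path

    T mn : V → ℕ
    T v  = ℓ false v + ℓ true v
    mn v = ℓ false v ⊓ ℓ true v

    T-split : ∀ b v → T v ≡ ℓ b v + ℓ (not b) v
    T-split false v = refl
    T-split true  v = +-comm (ℓ false v) (ℓ true v)

    mn≤ : ∀ b v → mn v ≤ ℓ b v
    mn≤ false v = m⊓n≤m _ _
    mn≤ true  v = m⊓n≤n (ℓ false v) _

    mn-glb : ∀ {x v} → (∀ b → x ≤ ℓ b v) → x ≤ mn v
    mn-glb h = ⊓-glb (h false) (h true)

    ℓ≤T : ∀ b v → ℓ b v ≤ T v
    ℓ≤T b v = subst (ℓ b v ≤_) (sym (T-split b v)) (m≤m+n _ _)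

    -- In these terms the i-th edge of p has tenacity on p i + off p (i + 1) + 1, matched or not.
    on off : (ℕ → V) → ℕ → ℕ
    on  p i = ℓ (par i) (p i)
    off p i = ℓ (not (par i)) (p i)

    on≤ : ∀ {p k i} → Path p k → i ≤ k → on p i ≤ i
    on≤ P i≤k = ℓ-min (prefix P i≤k)

    mn-on : ∀ {p k i} → Path p k → i ≤ k → mn (p i) ≤ i
    mn-on {i = i} P i≤k = ≤-trans (mn≤ (par i) _) (on≤ P i≤k)

    T≤off : ∀ {p k i} → Path p k → i ≤ k → T (p i) ≤ off p i + i
    T≤off {p} {i = i} P i≤k = subst₂ _≤_ (sym (T-split (par i) (p i))) (+-comm i _) (+-monoˡ-≤ (off p i) (on≤ P i≤k))

    -- Paths that end at their level, and the meeting argument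

    record Lev (p : ℕ → V) (k : ℕ) : Set where
      constructor _,_
      field
        path : Path p k
        lev  : on p k ≡ k

    open Lev public

    T-lev : ∀ {p k} → Lev p k → T (p k) ≡ k + off p k
    T-lev {p} {k} L = trans (T-split (par k) (p k)) (cong (_+ off p k) (L .lev))

    level-path : ∀ b v → ℓ b v < N → ∃₂ λ p k → Lev p k × p k ≡ v × par k ≡ b × k ≡ ℓ b v
    level-path b v h with ℓ-path b v h
    ... | p , P , e , pr = p , ℓ b v , (P , cong₂ ℓ pr e) , e , pr , refl

    -- With equal parities `s` can continue along `p` to its end; as `p` is shortest of its parity,
    -- `x + (k - j)` is at least `k`. With opposite parities `s` can turn back and reach `p i`, with
    -- the parity opposite to `i`, in `x + (j - i)` steps.
    meet : ∀ {p k s n i x j} → Lev p k → Path s n → x ≤ n → Hit s p i k x j →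
           (par x ≡ par j × j ≤ x) ⊎ (off p i + i ≤ x + j)
    meet {p} {k} {s} {n} {i} {x} {j} L S x≤n H with same-or-not (par x) (par j)
    ... | inj₁ eq with m≤n⇒∃[o]m+o≡n (Hit.j≤k H)
    ...   | d , refl = inj₁ (eq , +-cancelʳ-≤ d j x (subst (_≤ x + d) (L .lev)
              (subst (_≤ x + d) (cong₂ ℓ (par-+ʳ {x} {j} d eq) (join-+ s x _ d))
                (ℓ-min (forward-path j d x (L .path) (prefix S x≤n) (Hit.at H) eq
                  λ y<x j≤z → Hit.miss H y<x (≤-trans (Hit.i≤j H) j≤z))))))
    meet {p} {k} {s} {n} {i} {x} {j} L S x≤n H | inj₂ eq with m≤n⇒∃[o]m+o≡n (Hit.i≤j H)
    ...   | d , refl = inj₂ (subst (off p i + i ≤_) (trans (+-assoc x d i) (cong (x +_) (+-comm d i))) (+-monoˡ-≤ i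
              (subst (_≤ x + d) (cong₂ ℓ (par-shift x (suc i) d eq)
                  (trans (join-+ s x _ d) (cong p (trans (cong (i +_) (n∸n≡0 d)) (+-identityʳ i)))))
                (ℓ-min (backward-path i d x (prefix (L .path) (Hit.j≤k H)) (prefix S x≤n) (Hit.at H) eq
                  λ y<x i≤z z≤j → Hit.miss H y<x i≤z (≤-trans z≤j (Hit.j≤k H)))))))

    hit-end : ∀ (s p : ℕ → V) i k n {z} → i ≤ z → z ≤ k → s n ≡ p z → ∃₂ λ x j → x ≤ n × Hit s p i k x j
    hit-end s p i k n i≤z z≤k e with first-hit s p i k n
    ... | inj₁ h    = h
    ... | inj₂ none = ⊥-elim (none ≤-refl i≤z z≤k e)

    -- Apply `meet` to a shortest path of the other parity to `p k`; it hits `p` on `[i , k]`, at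
    -- the latest at its end.
    off-or-early : ∀ {p k i} → Lev p k → off p k < N → i ≤ k →
                   i ≤ off p k ⊎ off p i + i ≤ T (p k)
    off-or-early {p} {k} {i} L m<N i≤k with level-path (not (par k)) (p k) m<N
    ... | r , m , R , e , _ , m≡ with hit-end r p i k m i≤k ≤-refl e
    ... | x , j , x≤m , H with meet L (R .path) x≤m H
    ... | inj₁ (_ , j≤x) = inj₁ (≤-trans (Hit.i≤j H) (≤-trans j≤x (≤-trans x≤m (≤-reflexive m≡))))
    ... | inj₂ le = inj₂ (≤-trans le (subst (x + j ≤_) (sym (trans (T-lev L) (+-comm k _)))
                      (+-mono-≤ (≤-trans x≤m (≤-reflexive m≡)) (Hit.j≤k H))))

    -- By `off-or-early` only `i ≤ off p k` is left. Then `off p i < i` bounds the sum directly, and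
    -- if `on p i < i`, a path realising `on p i` is too short for a forward meeting, so it turns
    -- back.
    displaced : ∀ {p k i} → Lev p k → T (p k) < N → i ≤ k → on p i < i ⊎ off p i < i →
                off p i + i ≤ T (p k)
    displaced {p} {k} {i} L T<N i≤k c with off-or-early L (≤-<-trans (ℓ≤T _ _) T<N) i≤k
    ... | inj₂ le = le
    displaced {p} {k} {i} L T<N i≤k (inj₂ off<) | inj₁ i≤m = subst (off p i + i ≤_) (sym (trans (T-lev L) (+-comm k _)))
      (+-mono-≤ (≤-trans (<⇒≤ off<) i≤m) i≤k)
    displaced {p} {k} {i} L T<N i≤k (inj₁ on<) | inj₁ i≤m
      with level-path (par i) (p i) (≤-<-trans (≤-trans (<⇒≤ on<) (≤-trans i≤k (subst (k ≤_) (sym (T-lev L)) (m≤m+n k _)))) T<N)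
    ... | q , n , Q , e , _ , n≡ with hit-end q p i k n ≤-refl i≤k e
    ... | x , j , x≤n , H with meet L (Q .path) x≤n H
    ... | inj₁ (_ , j≤x) = ⊥-elim (<⇒≱ on< (≤-trans (Hit.i≤j H) (≤-trans j≤x (≤-trans x≤n (≤-reflexive n≡)))))
    ... | inj₂ le = ≤-trans le (subst (x + j ≤_) (sym (trans (T-lev L) (+-comm k _)))
                      (+-mono-≤ (≤-trans x≤n (≤-trans (≤-reflexive n≡) (≤-trans (<⇒≤ on<) i≤m))) (Hit.j≤k H)))

    -- Were `on p i` smaller than `i`, `displaced` would push the tenacity of `p i` below that of
    -- `p k`.
    honest : ∀ {p k i} → Lev p k → T (p k) < N → i ≤ k → T (p k) ≤ T (p i) → Lev p i
    honest {p} {k} {i} L T<N i≤k T≤ with m≤n⇒m<n∨m≡n (on≤ (L .path) i≤k)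
    ... | inj₂ eq  = prefix (L .path) i≤k , eq
    ... | inj₁ on< = ⊥-elim (<⇒≱ (subst (_< i + off p i) (sym (T-split (par i) (p i))) (+-monoˡ-< (off p i) on<))
                       (≤-trans (subst (_≤ T (p k)) (+-comm (off p i) i) (displaced L T<N i≤k (inj₁ on<))) T≤))

    undisplaced : ∀ {p k i} → Lev p k → T (p k) < N → i ≤ k → T (p k) < off p i + i → ∀ b → i ≤ ℓ b (p i)
    undisplaced {p} {k} {i} L T<N i≤k T< b with i ≤? ℓ b (p i)
    ... | yes h = h
    ... | no i≰ = ⊥-elim (<⇒≱ T< (displaced L T<N i≤k (side (same-or-not b (par i)))))
      where
      side : b ≡ par i ⊎ b ≡ not (par i) → on p i < i ⊎ off p i < i
      side (inj₁ refl) = inj₁ (≰⇒> i≰)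
      side (inj₂ refl) = inj₂ (≰⇒> i≰)

    minimal : ∀ {p k i} → Lev p k → T (p k) < N → i ≤ k → T (p k) < T (p i) → ∀ b → i ≤ ℓ b (p i)
    minimal L T<N i≤k T< = undisplaced L T<N i≤k (<-≤-trans T< (T≤off (L .path) i≤k))

    -- A shortest path to `u` of the parity that fits the edge either passes through `w` already or
    -- extends to it.
    edge-mn : ∀ {b u w} → Ed b u w → ℓ b u < N → mn w ≤ suc (ℓ b u)
    edge-mn {b} {u} {w} e h with level-path b u h
    ... | p , k , L , refl , refl , k≡ with on-path? p k w
    ... | inj₁ (x , x≤k , refl) = ≤-trans (mn-on (L .path) x≤k) (≤-trans x≤k (≤-trans (≤-reflexive k≡) (n≤1+n _)))
    ... | inj₂ new = subst₂ (λ v l → mn v ≤ l) (snoc-end p k w) (trans (+-comm k 1) (cong suc k≡))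
                       (mn-on (snoc-path (L .path) e new) ≤-refl)

    -- Last high vertices and bases

    record LastHigh (τ : ℕ) (p : ℕ → V) (k x : ℕ) : Set where
      field
        x≤k  : x ≤ k
        high : τ ≤ T (p x)
        tail : ∀ {y} → x < y → y ≤ k → T (p y) < τ

    open LastHigh public

    last-high : ∀ {τ p k} → τ ≤ t → Path p k → ∃ (LastHigh τ p k)
    last-high {τ} {p} {k} τ≤t P with last (λ y → τ ≤? T (p y)) k z≤n (≤-trans τ≤t (free-high (P .free)))
    ... | x , _ , x≤k , h , above = x , record { x≤k = x≤k ; high = h ; tail = λ x<y y≤k → ≰⇒> (above x<y y≤k) }

    shorten : ∀ {τ p k x i} → LastHigh τ p k x → x ≤ i → i ≤ k → LastHigh τ p i x
    shorten H x≤i i≤k = record { x≤k = x≤i ; high = H .high ; tail = λ x<y y≤i → H .tail x<y (≤-trans y≤i i≤k) }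

    high≤last : ∀ {τ p k x y} → LastHigh τ p k x → y ≤ k → τ ≤ T (p y) → y ≤ x
    high≤last {x = x} {y} H y≤k h with y ≤? x
    ... | yes y≤x = y≤x
    ... | no y≰x  = ⊥-elim (<⇒≱ (H .tail (≰⇒> y≰x) y≤k) h)

    SameBase : ℕ → V → Set
    SameBase τ u = ∀ {p k q n x y} → Lev p k → p k ≡ u → Lev q n → q n ≡ u →
                   LastHigh τ p k x → LastHigh τ q n y → p x ≡ q y

    -- The base of a low vertex on p is one of the two high vertices of p that surround it.
    Segments : ℕ → Set
    Segments τ = ∀ {p k i q n x} → Lev p k → T (p k) ≡ τ → i ≤ k → T (p i) < τ →
                 Lev q n → q n ≡ p i → LastHigh τ q n x →
                 ∃ λ j → j ≤ k × q x ≡ p j × (∀ {h} → h ≤ i → τ ≤ T (p h) → h ≤ j)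

    -- Uniqueness of the base for one threshold

    module Threshold (τ : ℕ) (τ≤t : τ ≤ t) (segments : ∀ {σ} → σ < τ → Segments σ) where

      low<N : ∀ {x} → x < τ → x < N
      low<N x<τ = <-trans (<-≤-trans x<τ τ≤t) t<N

      -- One level below `M` is enough, so `M` bounds the minlevel of `w`, on which uniqueness of
      -- the base is proved by induction.
      BaseBelow : ℕ → Set
      BaseBelow M = ∀ {w b} → T w < τ → ℓ b w < M → SameBase τ w

      -- The base of p k is also the base of each vertex of p after it, even if p does not visit that vertex at
      -- its level: at threshold T (p k) its base is on p by Segments, and p visits that base at its level.
      chain : ∀ {M p k f i q n x} → BaseBelow M → Lev p k → T (p k) < τ → LastHigh τ p k f → f < i → i ≤ k →
              Lev q n → q n ≡ p i → n < M → LastHigh τ q n x → q x ≡ p f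
      chain {M} {p} {k} {f} {i} {q} {n} {x} B L Tk<τ F f<i i≤k Q qn≡ n<M X with T (p k) ≤? T (p i)
      -- Here `p` visits `p i` at its level, so uniqueness applies to `q` and a prefix of `p`.
      ... | yes Tk≤ = B {p i} {par n} (F .tail f<i i≤k)
                        (subst (_< M) (trans (sym (Q .lev)) (cong (ℓ (par n)) qn≡)) n<M)
                        Q qn≡ (honest L (low<N Tk<τ) i≤k Tk≤) refl X (shorten F (<⇒≤ f<i) i≤k)
      ... | no Tk≰ with last-high (≤-trans (<⇒≤ Tk<τ) τ≤t) (Q .path)
      ... | y , Y with segments Tk<τ L refl i≤k (≰⇒> Tk≰) Q qn≡ Y
      ... | j , j≤k , qy≡pj , bound = conclude
        where
        f≤j : f ≤ j
        f≤j = bound (<⇒≤ f<i) (≤-trans (<⇒≤ Tk<τ) (F .high))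
        x≤y : x ≤ y
        x≤y = high≤last Y (X .x≤k) (≤-trans (<⇒≤ Tk<τ) (X .high))
        Qy : Lev q y
        Qy = honest Q (low<N (subst (λ v → T v < τ) (sym qn≡) (F .tail f<i i≤k))) (Y .x≤k)
               (≤-trans (<⇒≤ (subst (λ v → T v < T (p k)) (sym qn≡) (≰⇒> Tk≰))) (Y .high))
        conclude : q x ≡ p f
        conclude with τ ≤? T (p j)
        -- Both paths visit the base for the smaller threshold at their level. If it is low for `τ`,
        -- uniqueness applies to it; if not, it is the last high vertex of both.
        ... | no low = B {p j} {par y} (≰⇒> low)
                         (subst (_< M) (trans (sym (Qy .lev)) (cong (ℓ (par y)) qy≡pj)) (≤-<-trans (Y .x≤k) n<M))
                         Qy qy≡pj (honest L (low<N Tk<τ) j≤k (subst (λ v → T (p k) ≤ T v) qy≡pj (Y .high))) refl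
                         (shorten X x≤y (Y .x≤k)) (shorten F f≤j j≤k)
        ... | yes hi = trans (cong q (≤-antisym x≤y (high≤last X (Y .x≤k) (subst (λ v → τ ≤ T v) (sym qy≡pj) hi))))
                         (trans qy≡pj (cong p (≤-antisym (high≤last F j≤k hi) f≤j)))

      -- Turning back along p to its last high vertex would give that vertex tenacity less than τ.
      blocked : ∀ {p k f c} → Path p k → LastHigh τ p k f → off p f + f ≤ c → c < τ → ⊥
      blocked P F le c<τ = <⇒≱ c<τ (≤-trans (F .high) (≤-trans (T≤off P (F .x≤k)) le))

      Forward : (s : ℕ → V) (n : ℕ) (p : ℕ → V) (i k : ℕ) → Set
      Forward s n p i k = ∃₂ λ x j → Hit s p i k x j × x ≤ n × par x ≡ par j × j ≤ x

      forward : ∀ {p k f s n x j} → Lev p k → LastHigh τ p k f → Path s n → n + k < τ →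
                x ≤ n → Hit s p f k x j → Forward s n p f k
      forward L F S n+k<τ x≤n H with meet L S x≤n H
      ... | inj₁ (pr , j≤x) = _ , _ , H , x≤n , pr , j≤x
      ... | inj₂ le = ⊥-elim (blocked (L .path) F (≤-trans le (+-mono-≤ x≤n (Hit.j≤k H))) n+k<τ)

      -- If the common vertex is the last high vertex of one path, it is high and therefore also the
      -- last high vertex of the other. Only a crossing strictly after both needs an argument.
      tails : ∀ {p k f q n g a b} → LastHigh τ p k f → LastHigh τ q n g →
              (f < a → g < b → p f ≡ q g) →
              f ≤ a → a ≤ k → g ≤ b → b ≤ n → p a ≡ q b → p f ≡ q g
      tails {p} {q = q} F G strict f≤a a≤k g≤b b≤n e with m≤n⇒m<n∨m≡n f≤a | m≤n⇒m<n∨m≡n g≤b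
      ... | inj₁ f<a  | inj₁ g<b  = strict f<a g<b
      ... | inj₂ refl | _ = trans e (cong q (≤-antisym (high≤last G b≤n (subst (λ v → τ ≤ T v) e (F .high))) g≤b))
      ... | _ | inj₂ refl = trans (cong p (sym (≤-antisym (high≤last F a≤k (subst (λ v → τ ≤ T v) (sym e) (G .high))) f≤a))) e

      -- If q reached p before its own last high vertex and vice versa, the two inequalities j ≤ x would form
      -- a cycle.
      cross : ∀ {p k f q n g} → LastHigh τ p k f → LastHigh τ q n g →
              Forward q n p f k → Forward p k q g n →
              (∀ {a b} → f < a → a ≤ k → g < b → b ≤ n → p a ≡ q b → par a ≡ par b → p f ≡ q g) →
              p f ≡ q g
      cross {f = f} {g = g} F G (x , j , H , x≤n , pr , j≤x) (x′ , j′ , H′ , x′≤k , pr′ , j′≤x′) strict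
        with g ≤? x | f ≤? x′
      ... | no g≰x  | no f≰x′  = ⊥-elim (<-irrefl refl (<-≤-trans (≰⇒> g≰x) (≤-trans (Hit.i≤j H′) (≤-trans j′≤x′
                                   (≤-trans (<⇒≤ (≰⇒> f≰x′)) (≤-trans (Hit.i≤j H) j≤x))))))
      ... | yes g≤x | _        = tails F G (λ f<j g<x → strict f<j (Hit.j≤k H) g<x x≤n (sym (Hit.at H)) (sym pr))
                                   (Hit.i≤j H) (Hit.j≤k H) g≤x x≤n (sym (Hit.at H))
      ... | no _    | yes f≤x′ = tails F G (λ f<x g<j → strict f<x x′≤k g<j (Hit.j≤k H′) (Hit.at H′) pr′)
                                   f≤x′ x′≤k (Hit.i≤j H′) (Hit.j≤k H′) (Hit.at H′)

      -- Neither path need visit the shared vertex at its level, so a shortest path `r` to it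
      -- mediates: `chain` compares the base of `r` with each side.
      same-base-via : ∀ {M p k f q n g a b} → BaseBelow M → Lev p k → LastHigh τ p k f → Lev q n → LastHigh τ q n g →
                      f < a → a ≤ k → g < b → b ≤ n → p a ≡ q b → on p a < M → p f ≡ q g
      same-base-via {p = p} {a = a} B L F Q G f<a a≤k g<b b≤n e on<M
        with level-path (par a) (p a) (low<N (≤-<-trans (ℓ≤T _ _) (F .tail f<a a≤k)))
      ... | r , m , R , rm≡ , _ , m≡ with last-high τ≤t (R .path)
      ... | y , Y = trans
        (sym (chain B L (F .tail (<-≤-trans f<a a≤k) ≤-refl) F f<a a≤k R rm≡ (subst (_< _) (sym m≡) on<M) Y))
        (chain B Q (G .tail (<-≤-trans g<b b≤n) ≤-refl) G g<b b≤n R (trans rm≡ e) (subst (_< _) (sym m≡) on<M) Y)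

      -- The lengths add up to the tenacity of the common end, so neither path can turn back along
      -- the other. A meeting with equal parities is not that end, hence it lies strictly earlier on
      -- both paths and has a level below both `k` and `n`.
      same-base-opposite : ∀ {M p k f q n g} → BaseBelow M → Lev p k → LastHigh τ p k f → Lev q n → LastHigh τ q n g →
                           p k ≡ q n → par k ≡ not (par n) → T (p k) < τ → k ≤ M ⊎ n ≤ M → p f ≡ q g
      same-base-opposite {M} {p} {k} {f} {q} {n} {g} B L F Q G e opp low short
        with hit-end q p f k n (F .x≤k) ≤-refl (sym e) | hit-end p q g n k (G .x≤k) ≤-refl e
      ... | x , j , x≤n , H | x′ , j′ , x′≤k , H′ =
        cross F G (forward L F (Q .path) (subst (_< τ) (+-comm k n) k+n<τ) x≤n H)
          (forward Q G (L .path) k+n<τ x′≤k H′) strict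
        where
        k+n<τ : k + n < τ
        k+n<τ = subst (_< τ) (trans (T-lev L) (cong (k +_)
          (trans (cong₂ ℓ (trans (cong not opp) (Bool.not-involutive _)) e) (Q .lev)))) low
        strict : ∀ {a b} → f < a → a ≤ k → g < b → b ≤ n → p a ≡ q b → par a ≡ par b → p f ≡ q g
        strict {a} {b} f<a a≤k g<b b≤n e′ pab = same-base-via B L F Q G f<a a≤k g<b b≤n e′ (bound short)
          where
          par-clash : par k ≢ par n
          par-clash eq = Bool.not-¬ eq opp
          a<k : a < k
          a<k = ≤∧≢⇒< a≤k λ { refl → par-clash (trans pab (cong par (Q .path .inj b≤n ≤-refl (trans (sym e′) e)))) }
          b<n : b < n
          b<n = ≤∧≢⇒< b≤n λ { refl → par-clash (trans (cong par (L .path .inj ≤-refl a≤k (trans e (sym e′)))) pab) }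
          bound : k ≤ M ⊎ n ≤ M → on p a < M
          bound (inj₁ k≤M) = <-≤-trans (≤-<-trans (on≤ (L .path) a≤k) a<k) k≤M
          bound (inj₂ n≤M) = <-≤-trans (≤-<-trans (subst (_≤ b) (cong₂ ℓ (sym pab) (sym e′)) (on≤ (Q .path) b≤n)) b<n) n≤M

      -- Two paths of opposite parity to w meet strictly before w, at a vertex of smaller minlevel.
      base-below : ∀ M → BaseBelow M
      base-below zero    _ ()
      base-below (suc M) {w} {b} low ℓ<M {p} {k} {q} {n} L pk≡ Q qn≡ F G with same-or-not (par k) (par n)
      ... | inj₂ opp = same-base-opposite (base-below M) L F Q G (trans pk≡ (sym qn≡)) opp (subst (λ v → T v < τ) (sym pk≡) low) short
        where
        short : k ≤ M ⊎ n ≤ M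
        short with same-or-not b (par n)
        ... | inj₁ refl = inj₂ (≤-pred (subst (_< suc M) (trans (cong (ℓ (par n)) (sym qn≡)) (Q .lev)) ℓ<M))
        ... | inj₂ eq = inj₁ (≤-pred (subst (_< suc M) (trans (cong₂ ℓ (trans eq (sym opp)) (sym pk≡)) (L .lev)) ℓ<M))
      -- Two paths of equal parity are both compared with a shortest path of the other parity.
      ... | inj₁ same with level-path (not (par k)) w (low<N (≤-<-trans (ℓ≤T _ _) low))
      ... | r , m , R , rm≡ , pm , m≡ with last-high τ≤t (R .path)
      ... | y , Y = trans (go L pk≡ F refl) (sym (go Q qn≡ G (sym same)))
        where
        go : ∀ {s l z} → Lev s l → s l ≡ w → LastHigh τ s l z → par l ≡ par k → s z ≡ r y
        go {s} {l} S sl≡ Z pl = same-base-opposite (base-below M) S Z R Y (trans sl≡ (sym rm≡))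
          (trans pl (trans (sym (Bool.not-involutive _)) (cong not (sym pm)))) (subst (λ v → T v < τ) (sym sl≡) low) short
          where
          short : l ≤ M ⊎ m ≤ M
          short with same-or-not b (par k)
          ... | inj₁ eq = inj₁ (≤-pred (subst (_< suc M) (trans (cong₂ ℓ (trans eq (sym pl)) (sym sl≡)) (S .lev)) ℓ<M))
          ... | inj₂ refl = inj₂ (≤-pred (subst (_< suc M) (sym m≡) ℓ<M))

      same-base : ∀ {w} → T w < τ → SameBase τ w
      same-base {w} low = base-below N {w} {true} low (low<N (≤-<-trans (ℓ≤T _ _) low))

      -- If `q` misses the segment, the edge extends it to `p k` with the parity opposite to `k`,
      -- and turning back from there would reach `p f` too cheaply.
      edge-forward : ∀ {p k f q n} → Lev p k → LastHigh τ p k f → Path q n → Ed (par n) (q n) (p k) →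
                     par n ≡ par k → suc (n + k) < τ → Forward q n p f k
      edge-forward {p} {k} {f} {q} {n} L F Q e pr n+k<τ with first-hit q p f k n
      ... | inj₁ (x , j , x≤n , H) = forward L F Q (<-trans (n<1+n _) n+k<τ) x≤n H
      ... | inj₂ none = ⊥-elim clash
        where
        new : ∀ {x} → x ≤ n → q x ≢ p k
        new x≤n = none x≤n (F .x≤k) ≤-refl
        H : Hit (snoc q n (p k)) p f k (n + 1) k
        H = record { i≤j = F .x≤k ; j≤k = ≤-refl ; at = snoc-end q n (p k)
          ; miss = λ {y} y<n+1 f≤z z≤k eq → let y≤n = ≤-pred (subst (y <_) (+-comm n 1) y<n+1) in
              none y≤n f≤z z≤k (trans (sym (snoc-≤ q n (p k) y≤n)) eq) }
        clash : ⊥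
        clash with meet L (snoc-path Q e new) ≤-refl H
        ... | inj₁ (eq , _) = Bool.not-¬ (sym pr) (trans (sym eq) (cong par (+-comm n 1)))
        ... | inj₂ le = blocked (L .path) F le (subst (_< τ) (sym (cong (_+ k) (+-comm n 1))) n+k<τ)

      -- The argument for opposite parities again, with the edge in place of the common end.
      -- Uniqueness is now known for all low vertices, so the bound on the level of a meeting is
      -- simply `N`.
      edge-base : ∀ {p k f q n g} → Lev p k → LastHigh τ p k f → Lev q n → LastHigh τ q n g →
                  Ed (par k) (p k) (q n) → par n ≡ par k → suc (k + n) < τ → p f ≡ q g
      edge-base {p} {k} {f} {q} {n} {g} L F Q G e pr small = cross F G
        (edge-forward L F (Q .path) (Ed-sym (subst (λ b → Ed b (p k) (q n)) (sym pr) e)) pr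
          (subst (λ s → suc s < τ) (+-comm k n) small))
        (edge-forward Q G (L .path) e (sym pr) small)
        λ {a} f<a a≤k g<b b≤n e′ _ → same-base-via (base-below N) L F Q G f<a a≤k g<b b≤n e′
          (low<N (≤-<-trans (ℓ≤T _ _) (F .tail f<a a≤k)))

      -- Bases along a path to a vertex of tenacity `τ`

      τ<N : τ < N
      τ<N = ≤-<-trans τ≤t t<N

      -- p is not at its level at i, so a shortest path r to p i must pass through p (i + 1), and it does so at
      -- the minlevel of that vertex. As r followed by the edge back to p i is then a path of the other parity,
      -- no high vertex of r can come later.
      step-base : ∀ {p k i q n x} → Lev p k → T (p k) ≡ τ → suc i ≤ k → τ ≤ T (p (suc i)) → T (p i) < τ → on p i < i →
                  Lev q n → q n ≡ p i → LastHigh τ q n x → q x ≡ p (suc i)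
      step-base {p} {k} {i} L Tk≡ i<k hi low on<i Q qn≡ X
        with level-path (par i) (p i) (low<N (≤-<-trans (ℓ≤T _ _) low))
      ... | r , m , R , rm≡ , pm , m≡ with on-path? r m (p (suc i)) | honest L (subst (_< N) (sym Tk≡) τ<N) i<k (subst (_≤ T (p (suc i))) (sym Tk≡) hi)
      ... | inj₂ new | Lb = ⊥-elim (<⇒≱ (s≤s (subst (_< i) (sym m≡) on<i)) (subst₂ _≤_
              (trans (cong₂ ℓ (trans (cong par (+-comm m 1)) (cong not pm)) (snoc-end r m _)) (Lb .lev)) (+-comm m 1)
              (ℓ-min (snoc-path (R .path) (subst₂ (λ b v → Ed b v (p (suc i))) (sym pm) (sym rm≡) (L .path .step i<k)) new))))
      ... | inj₁ (y , y≤m , ry≡) | Lb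
        with level-path (not (par i)) (p i) (low<N (≤-<-trans (ℓ≤T _ _) low))
      ... | s , l , S , sl≡ , _ , l≡ with last-high τ≤t (R .path) | last-high τ≤t (S .path)
      ... | w , W | z , Z = trans (same-base low Q qn≡ R rm≡ X W) (trans (cong r (≤-antisym (≤-trans w≤z z≤y) y≤w)) ry≡)
        where
        rm-low : T (r m) < τ
        rm-low = subst (λ v → T v < τ) (sym rm≡) low
        y<m : y < m
        y<m = ≤∧≢⇒< y≤m λ { refl → 1+n≢n (L .path .inj i<k (<⇒≤ i<k) (trans (sym ry≡) rm≡)) }
        ry-high : τ ≤ T (r y)
        ry-high = subst (λ v → τ ≤ T v) (sym ry≡) hi
        -- With the other parity `r` would visit `p (suc i)` at the same level as `p` does, so `y`
        -- would be `suc i`; but `y < m < suc i`.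
        par-y : par y ≡ par i
        par-y with same-or-not (par y) (par i)
        ... | inj₁ eq = eq
        ... | inj₂ eq = ⊥-elim (<⇒≢ (<-trans y<m (subst (_< suc i) (sym m≡) (m<n⇒m<1+n on<i)))
              (trans (sym (honest R (low<N rm-low) y≤m (≤-trans (<⇒≤ rm-low) ry-high) .lev)) (trans (cong₂ ℓ eq ry≡) (Lb .lev))))
        l≤ : l ≤ suc y
        l≤ = subst₂ _≤_ (trans (cong₂ ℓ (trans (cong par (+-comm y 1)) (cong not par-y)) (snoc-end r y (p i))) (sym l≡)) (+-comm y 1)
               (ℓ-min (snoc-path (prefix (R .path) y≤m)
                 (subst₂ (λ b v → Ed b v (p i)) (sym par-y) (sym ry≡) (Ed-sym (L .path .step i<k)))
                 λ x≤y e → <⇒≢ (≤-<-trans x≤y y<m) (R .path .inj (≤-trans x≤y y≤m) ≤-refl (trans e (sym rm≡)))))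
        z<l : z < l
        z<l = ≤∧≢⇒< (Z .x≤k) λ { refl → <⇒≱ low (subst (λ v → τ ≤ T v) sl≡ (Z .high)) }
        z≤y : z ≤ y
        z≤y = ≤-pred (≤-trans z<l l≤)
        y≤w : y ≤ w
        y≤w = high≤last W y≤m ry-high
        -- `r` visits its base at the minlevel of that vertex, and `s` has the same base.
        w≤z : w ≤ z
        w≤z = ≤-trans (minimal R (low<N rm-low) (W .x≤k) (<-≤-trans rm-low (W .high)) (par z))
                (subst (_≤ z) (cong (ℓ (par z)) (same-base low S sl≡ R rm≡ Z W)) (on≤ (S .path) (Z .x≤k)))

      -- No vertex of the stretch is visited at its level, so by `displaced` each edge inside it has
      -- tenacity below `τ`. Thus `edge-base` carries the base from vertex to vertex, and
      -- `step-base` settles the last one before `b`.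
      tail-base : ∀ {p k b} → Lev p k → T (p k) ≡ τ → b ≤ k → τ ≤ T (p b) → ∀ d {i} → suc i + d ≡ b →
                  (∀ {y} → i ≤ y → y < b → T (p y) < τ × on p y < y) →
                  ∀ {q n x} → Lev q n → q n ≡ p i → LastHigh τ q n x → q x ≡ p b
      tail-base L Tk≡ b≤k hi zero {i} refl lows rewrite +-identityʳ i =
        step-base L Tk≡ b≤k hi (lows ≤-refl ≤-refl .proj₁) (lows ≤-refl ≤-refl .proj₂)
      tail-base {p} {k} {b} L Tk≡ b≤k hi (suc d) {i} eq lows {q} {n} {x} Q qn≡ X
        with lows {i} ≤-refl (<-≤-trans (n<1+n i) (m+n≤o⇒m≤o (suc i) (≤-reflexive eq)))
           | lows {suc i} (n≤1+n i) (m+n≤o⇒m≤o (suc (suc i)) (≤-reflexive (trans (sym (+-suc (suc i) d)) eq)))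
      ... | lowᵢ , onᵢ | low , on<
        with level-path (par i) (p i) (low<N (≤-<-trans (ℓ≤T _ _) lowᵢ))
           | level-path (not (par (suc i))) (p (suc i)) (low<N (≤-<-trans (ℓ≤T _ _) low))
      ... | r , m , R , rm≡ , pm , m≡ | s , l , S , sl≡ , pl , l≡ with last-high τ≤t (R .path) | last-high τ≤t (S .path)
      ... | w , W | z , Z = trans (same-base lowᵢ Q qn≡ R rm≡ X W) (trans
            (edge-base R W S Z (subst₂ (Ed (par m)) (sym rm≡) (sym sl≡) (subst (λ b → Ed b (p i) (p (suc i))) (sym pm) (L .path .step i<k)))
              (trans pl (trans (Bool.not-involutive _) (sym pm))) small)
            (tail-base L Tk≡ b≤k hi d (trans (sym (+-suc (suc i) d)) eq) (λ i<y → lows (<⇒≤ i<y)) S sl≡ Z))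
        where
        i<k : i < k
        i<k = ≤-trans (m+n≤o⇒m≤o (suc i) (≤-reflexive eq)) b≤k
        small : suc (m + l) < τ
        small = <-≤-trans (s≤s (+-mono-<-≤ (subst (_< i) (sym m≡) onᵢ) (≤-reflexive l≡)))
          (subst₂ _≤_ (trans (+-suc _ i) (cong suc (+-comm _ i))) Tk≡
            (displaced L (subst (_< N) (sym Tk≡) τ<N) i<k (inj₁ on<)))

      -- Let `b` be the next high index. If `p` visits some `c` in `[i , b)` at its level, `chain`
      -- along the prefix up to `c` gives the base `p a`; otherwise `tail-base` gives `p b`.
      segments-here : Segments τ
      segments-here {p} {k} {i} {q} {n} {x} L Tk≡ i≤k low Q qn≡ X
        with first (λ y → (i ≤? y) ×-dec (τ ≤? T (p y))) k | last-high τ≤t (prefix (L .path) i≤k)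
      ... | inj₂ none | _ = ⊥-elim (none ≤-refl (i≤k , ≤-reflexive (sym Tk≡)))
      ... | inj₁ (b , b≤k , (i≤b , hi) , below) | a , A with anyUpTo? (λ c → (i ≤? c) ×-dec (on p c Nat.≟ c)) b
      ... | yes (c , c<b , i≤c , honest-c) = a , ≤-trans (A .x≤k) i≤k ,
              chain (base-below N) (prefix (L .path) (<⇒≤ c<k) , honest-c) (lows i≤c c<b) C a<i i≤c Q qn≡ n<N X ,
              λ h≤i hh → high≤last A h≤i hh
        where
        c<k : c < k
        c<k = <-≤-trans c<b b≤k
        lows : ∀ {y} → i ≤ y → y < b → T (p y) < τ
        lows i≤y y<b = ≰⇒> λ h → below y<b (i≤y , h)
        a<i : a < i
        a<i = ≤∧≢⇒< (A .x≤k) λ { refl → <⇒≱ low (A .high) }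
        C : LastHigh τ p c a
        C = record { x≤k = ≤-trans (A .x≤k) i≤c ; high = A .high ; tail = tail′ }
          where
          tail′ : ∀ {y} → a < y → y ≤ c → T (p y) < τ
          tail′ {y} a<y y≤c with y ≤? i
          ... | yes y≤i = A .tail a<y y≤i
          ... | no  y≰i = lows (<⇒≤ (≰⇒> y≰i)) (≤-<-trans y≤c c<b)
        n<N : n < N
        n<N = subst (_< N) (Q .lev) (low<N (≤-<-trans (ℓ≤T _ _) (subst (λ v → T v < τ) (sym qn≡) low)))
      ... | no none with m≤n⇒∃[o]m+o≡n (≤∧≢⇒< i≤b λ { refl → <⇒≱ low hi })
      ... | d , eq = b , b≤k , tail-base L Tk≡ b≤k hi d eq
              (λ i≤y y<b → ≰⇒> (λ h → below y<b (i≤y , h)) ,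
                ≤∧≢⇒< (on≤ (L .path) (<⇒≤ (<-≤-trans y<b b≤k))) (λ e → none (_ , y<b , i≤y , e))) Q qn≡ X ,
              λ h≤i _ → ≤-trans h≤i i≤b

    segments-at : ∀ τ → τ ≤ t → Segments τ
    segments-at = <-rec (λ τ → τ ≤ t → Segments τ)
      λ τ rec τ≤t → Threshold.segments-here τ τ≤t λ σ<τ → rec σ<τ (≤-trans (<⇒≤ σ<τ) τ≤t)

    -- The bridge of tenacity `t` on a maxlevel path

    open Threshold t ≤-refl (λ {σ} σ<t → segments-at σ (<⇒≤ σ<t))

    -- Both `on p i` and `off p (suc i)` are levels of the parity that the edge after `i` requires,
    -- so each disjunct says that crossing the edge in one direction attains the minlevel of the far
    -- end.
    PropAt : (ℕ → V) → ℕ → Set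
    PropAt p i = suc (on p i) ≡ mn (p (suc i)) ⊎ suc (off p (suc i)) ≡ mn (p i)

    par-ℓ : ∀ b v → ℓ b v < N → par (ℓ b v) ≡ b
    par-ℓ b v h = ℓ-path b v h .proj₂ .proj₂ .proj₂

    module Bridge
      {p : ℕ → V} {k a b c : ℕ} (L : Lev p k) (Tk≡ : T (p k) ≡ t) (off<k : off p k < k)
      (b≤k : b ≤ k) (b-high : t ≤ T (p b)) (b-off : off p b < b)
      (b-first : ∀ {y} → y < b → t ≤ T (p y) → y ≤ off p y)
      (a-high : t ≤ T (p a)) (a-last : ∀ {y} → a < y → y < b → T (p y) < t)
      (a≤c : a ≤ c) (c<b : c < b) (c-honest : on p c ≡ c) (c-last : ∀ {y} → c < y → y < b → on p y < y)
      where

      Tk<N : T (p k) < N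
      Tk<N = subst (_< N) (sym Tk≡) t<N

      k≤t : k ≤ t
      k≤t = subst (k ≤_) (trans (sym (T-lev L)) Tk≡) (m≤m+n k _)

      c<k : c < k
      c<k = <-≤-trans c<b b≤k

      Lc : Lev p c
      Lc = prefix (L .path) (<⇒≤ c<k) , c-honest

      displaced-t : ∀ {i} → i ≤ k → on p i < i ⊎ off p i < i → off p i + i ≤ t
      displaced-t i≤k h = subst (_ ≤_) Tk≡ (displaced L Tk<N i≤k h)

      off-b : off p b + b ≡ t
      off-b = ≤-antisym (displaced-t b≤k (inj₂ b-off)) (≤-trans b-high (T≤off (L .path) b≤k))

      t<b+b : t < b + b
      t<b+b = subst (_< b + b) off-b (+-monoˡ-< b b-off)

      -- For `suc c = b` this is `off-b`. Otherwise a smaller tenacity would give both ends the same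
      -- base by `edge-base`, but the bases are `p a` and `p b`, which are distinct.
      tenacity-c : suc (c + off p (suc c)) ≡ t
      tenacity-c with m≤n⇒m<n∨m≡n c<b
      ... | inj₂ refl = trans (cong suc (+-comm c _)) (trans (sym (+-suc _ c)) off-b)
      ... | inj₁ sc<b with m≤n⇒m<n∨m≡n (displaced-t c<k (inj₁ (c-last ≤-refl sc<b)))
      ...   | inj₂ eq = trans (cong suc (+-comm c _)) (trans (sym (+-suc _ c)) eq)
      ...   | inj₁ small with level-path (not (par (suc c))) (p (suc c)) (low<N (≤-<-trans (ℓ≤T _ _) (a-last (s≤s a≤c) sc<b)))
      ...     | q , n , Q , qn≡ , pn , n≡ with last-high ≤-refl (Q .path) | m≤n⇒∃[o]m+o≡n sc<b
      ...       | g , G | d , eq = ⊥-elim (<⇒≢ (≤-<-trans a≤c c<b) (L .path .inj (≤-trans a≤c (<⇒≤ c<k)) b≤k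
                    (trans (edge-base Lc A Q G (subst (Ed (par c) (p c)) (sym qn≡) (L .path .step c<k))
                        (trans pn (Bool.not-involutive _))
                        (subst (_< t) (trans (+-suc _ c) (cong suc (trans (+-comm _ c) (cong (c +_) (sym n≡))))) small))
                      (tail-base L Tk≡ b≤k b-high d eq
                        (λ c<y y<b → a-last (≤-<-trans a≤c c<y) y<b , c-last c<y y<b) Q qn≡ G))))
        where
        A : LastHigh t p c a
        A = record { x≤k = a≤c ; high = a-high ; tail = λ a<y y≤c → a-last a<y (≤-<-trans y≤c c<b) }

      c-not-prop : ¬ PropAt p c
      c-not-prop (inj₁ eq) = <⇒≢ small (sym (trans (cong suc (sym c-honest)) eq))
        where
        small : mn (p (suc c)) < suc c
        small with m≤n⇒m<n∨m≡n c<b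
        ... | inj₂ refl = ≤-<-trans (mn≤ _ _) b-off
        ... | inj₁ sc<b = ≤-<-trans (mn≤ _ _) (c-last ≤-refl sc<b)
      -- If `p c` is low, its level `off p c` is already below `suc (off p (suc c))`. If it is high,
      -- its minlevel is `c`, and `eq` contradicts the parity of `off p (suc c)`.
      c-not-prop (inj₂ eq) with t ≤? T (p c)
      ... | no low = <⇒≢ (≤-<-trans (mn≤ _ _) (+-cancelˡ-< c (off p c) _
              (subst₂ _<_ (T-lev Lc) (sym (trans (+-suc c _) tenacity-c)) (≰⇒> low)))) (sym eq)
      ... | yes hi = Bool.not-¬ (sym (trans (par-ℓ _ _ o<N) (Bool.not-involutive (par c)))) (cong par c≡)
        where
        c≡ : c ≡ suc (off p (suc c))
        c≡ = trans (≤-antisym (mn-glb lb) (≤-trans (mn≤ (par c) _) (≤-reflexive c-honest))) (sym eq)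
          where
          lb : ∀ b → c ≤ ℓ b (p c)
          lb b with same-or-not b (par c)
          ... | inj₁ refl = ≤-reflexive (sym c-honest)
          ... | inj₂ refl = b-first c<b hi
        o<N : off p (suc c) < N
        o<N = <-trans (<-≤-trans (≤-reflexive (sym c≡)) (≤-trans (<⇒≤ c<k) k≤t)) t<N

      -- The alternative `y ≤ off p k` would give `b + b ≤ k + off p k = t`, against `t<b+b`.
      late : ∀ {y} → b ≤ y → y ≤ k → off p y + y ≤ t
      late {y} b≤y y≤k with off-or-early L (<-≤-trans off<k (≤-trans k≤t (<⇒≤ t<N))) y≤k
      ... | inj₂ le = subst (_ ≤_) Tk≡ le
      ... | inj₁ y≤m = ⊥-elim (<-irrefl refl (<-≤-trans t<b+b (≤-trans (+-mono-≤ (≤-trans b≤y y≤k) (≤-trans b≤y y≤m))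
                         (≤-reflexive (trans (sym (T-lev L)) Tk≡)))))

      prop-if-minimal : ∀ {i} → i < k → (∀ b → suc i ≤ ℓ b (p (suc i))) → on p i ≡ i × PropAt p i
      prop-if-minimal {i} i<k lb = suc-injective (≤-antisym on≤i (≤-trans (mn-glb lb) em)) ,
        inj₁ (≤-antisym (≤-trans on≤i (mn-glb lb)) em)
        where
        on≤i : suc (on p i) ≤ suc i
        on≤i = s≤s (on≤ (L .path) (<⇒≤ i<k))
        em : mn (p (suc i)) ≤ suc (on p i)
        em = edge-mn (L .path .step i<k) (≤-<-trans (≤-trans (≤-pred on≤i) (≤-trans (<⇒≤ i<k) k≤t)) t<N)

      early-high : ∀ {y} → y < b → t ≤ T (p y) → ∀ b → y ≤ ℓ b (p y)
      early-high {y} y<b hi b′ with same-or-not b′ (par y)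
      ... | inj₁ refl = ≤-reflexive (sym (honest L Tk<N (<⇒≤ (<-≤-trans y<b b≤k)) (subst (_≤ _) (sym Tk≡) hi) .lev))
      ... | inj₂ refl = b-first y<b hi

      -- If `p c` is high, take the vertex before the first high one from `suc i` on: that high
      -- vertex is visited at its minlevel, so its predecessor is visited at its level.
      honest-low : ∀ {i} → i < c → T (p (suc i)) < t → ∃ λ d → suc i ≤ d × d ≤ c × Lev p d × T (p d) < t
      honest-low {i} i<c low with t ≤? T (p c)
      ... | no low-c = c , i<c , ≤-refl , Lc , ≰⇒> low-c
      ... | yes hi with first (λ y → (suc i ≤? y) ×-dec (t ≤? T (p y))) c
      ...   | inj₂ none = ⊥-elim (none ≤-refl (i<c , hi))
      ...   | inj₁ (zero , _ , (() , _) , _)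
      ...   | inj₁ (suc d , d<c , (i<d , hi′) , below) = d , i<d′ , <⇒≤ d<c ,
              (prefix (L .path) (<⇒≤ d<k) , prop-if-minimal d<k (early-high (≤-<-trans d<c c<b) hi′) .proj₁) ,
              ≰⇒> (λ h → below ≤-refl (i<d′ , h))
        where
        d<k : d < k
        d<k = <-trans d<c c<k
        i<d′ : suc i ≤ d
        i<d′ = ≤-pred (≤∧≢⇒< i<d λ { refl → <⇒≱ low hi′ })

      -- If `p (suc i)` is low, the prefix up to `d` ends at a vertex of tenacity below `t`, while
      -- the tenacity of the edge makes `off p (suc i) + suc i` at least `t`. Hence `p` visits
      -- `p (suc i)` at its minlevel.
      before-c : ∀ {i} → i < c → suc (on p i + off p (suc i)) ≡ t → PropAt p i
      before-c {i} i<c eq with t ≤? T (p (suc i))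
      ... | yes hi = prop-if-minimal i<k (early-high (≤-<-trans i<c c<b) hi) .proj₂
        where i<k = <-trans i<c c<k
      ... | no low with honest-low i<c (≰⇒> low)
      ...   | d , i<d , d≤c , Ld , low-d = prop-if-minimal i<k (undisplaced Ld (<-trans low-d t<N) i<d
                (<-≤-trans low-d (subst₂ _≤_ eq (sym (trans (+-suc _ i) (cong suc (+-comm _ i))))
                  (s≤s (+-monoˡ-≤ _ (on≤ (L .path) (<⇒≤ i<k))))))) .proj₂
        where i<k = <-trans i<c c<k

      -- The tenacity falls short of `t`, because `on p i < i` while `off p (suc i) + suc i ≤ t`.
      between : ∀ {i} → c < i → i < b → suc (on p i + off p (suc i)) ≢ t
      between {i} c<i i<b eq = <-irrefl eq (<-≤-trans (s≤s (+-monoˡ-< _ (c-last c<i i<b)))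
        (subst (_≤ t) (trans (+-suc _ i) (cong suc (+-comm _ i))) bound))
        where
        bound : off p (suc i) + suc i ≤ t
        bound with m≤n⇒m<n∨m≡n i<b
        ... | inj₂ refl = ≤-reflexive off-b
        ... | inj₁ si<b = displaced-t (<⇒≤ (<-≤-trans si<b b≤k)) (inj₁ (c-last (m<n⇒m<1+n c<i) si<b))

      -- The edge is a prop when read backwards. Its tenacity forces `p` to be at its level at `i`;
      -- then `p i` is high, as otherwise `minimal` would contradict `b-off`, and its minlevel is
      -- `off p i`, attained across the edge.
      from-b : ∀ {i} → b ≤ i → i < k → suc (on p i + off p (suc i)) ≡ t → PropAt p i
      from-b {i} b≤i i<k eq = inj₂ (trans (sym off-i) (sym mn-i))
        where
        o : ℕ
        o = off p (suc i)
        bound : suc (i + o) ≤ t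
        bound = subst (_≤ t) (trans (+-suc _ i) (cong suc (+-comm _ i))) (late (m≤n⇒m≤1+n b≤i) i<k)
        Li : Lev p i
        Li = prefix (L .path) (<⇒≤ i<k) , ≤-antisym (on≤ (L .path) (<⇒≤ i<k))
               (+-cancelʳ-≤ o i (on p i) (≤-pred (≤-trans bound (≤-reflexive (sym eq)))))
        eq′ : suc (i + o) ≡ t
        eq′ = trans (cong (λ l → suc (l + o)) (sym (Li .lev))) eq
        hi : t ≤ T (p i)
        hi with t ≤? T (p i)
        ... | yes h = h
        ... | no low = ⊥-elim (<⇒≱ b-off (minimal Li (<-trans (≰⇒> low) t<N) b≤i (<-≤-trans (≰⇒> low) b-high) _))
        sum : i + off p i ≡ t
        sum = ≤-antisym (subst (_≤ t) (+-comm _ i) (late b≤i (<⇒≤ i<k))) (subst (t ≤_) (T-lev Li) hi)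
        off-i : off p i ≡ suc o
        off-i = +-cancelˡ-≡ i _ _ (trans sum (trans (sym eq′) (sym (+-suc i o))))
        off≤i : off p i ≤ i
        off≤i = <⇒≤ (+-cancelˡ-< i _ _ (subst (_< i + i) (sym sum) (<-≤-trans t<b+b (+-mono-≤ b≤i b≤i))))
        mn-i : mn (p i) ≡ off p i
        mn-i = ≤-antisym (mn≤ _ _) (mn-glb lb)
          where
          lb : ∀ b → off p i ≤ ℓ b (p i)
          lb b′ with same-or-not b′ (par i)
          ... | inj₁ refl = ≤-trans off≤i (≤-reflexive (sym (Li .lev)))
          ... | inj₂ refl = ≤-refl

      unique : ∀ {i} → i < k → suc (on p i + off p (suc i)) ≡ t → ¬ PropAt p i → i ≡ c
      unique {i} i<k eq ¬prop with <-cmp i c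
      ... | tri≈ _ i≡c _ = i≡c
      ... | tri< i<c _ _ = ⊥-elim (¬prop (before-c i<c eq))
      ... | tri> _ _ c<i with i <? b
      ...   | yes i<b = ⊥-elim (between c<i i<b eq)
      ...   | no  i≮b = ⊥-elim (¬prop (from-b (≮⇒≥ i≮b) i<k eq))

    unique-bridge : ∀ {p k} → Lev p k → T (p k) ≡ t → off p k < k →
      ∃ λ c → c < k × suc (on p c + off p (suc c)) ≡ t × ¬ PropAt p c ×
        (∀ {i} → i < k → suc (on p i + off p (suc i)) ≡ t → ¬ PropAt p i → i ≡ c)
    unique-bridge {p} {k} L Tk≡ off<k with first (λ y → (t ≤? T (p y)) ×-dec (off p y <? y)) k
    ... | inj₂ none = ⊥-elim (none ≤-refl (≤-reflexive (sym Tk≡) , off<k))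
    ... | inj₁ (zero , _ , (_ , ()) , _)
    ... | inj₁ (suc b , b<k , (hi , off<) , below)
      with last (λ y → t ≤? T (p y)) b z≤n (free-high (L .path .free))
    ... | a , _ , a≤b , a-hi , a-last
      with last (λ y → on p y Nat.≟ y) b a≤b
             (honest L (subst (_< N) (sym Tk≡) t<N) (≤-trans a≤b (<⇒≤ b<k)) (subst (_≤ T (p a)) (sym Tk≡) a-hi) .lev)
    ... | c , a≤c , c≤b , c-honest , c-last =
      c , B.c<k , trans (cong (λ l → suc (l + off p (suc c))) c-honest) B.tenacity-c , B.c-not-prop , B.unique
      where
      module B = Bridge L Tk≡ off<k b<k hi off<
        (λ y<b h → ≮⇒≥ λ o<y → below y<b (h , o<y))
        a-hi (λ a<y y<b → ≰⇒> (a-last a<y (≤-pred y<b))) a≤c (s≤s c≤b) c-honest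
        (λ c<y y<b → ≤∧≢⇒< (on≤ (L .path) (≤-trans (≤-pred y<b) (<⇒≤ b<k))) (c-last c<y (≤-pred y<b)))

-- Parities and extended levels as natural numbers

par⇒%2 : ∀ k → (par k ≡ false → Even k) × (par k ≡ true → Odd k)
par⇒%2 zero          = (λ _ → refl) , λ ()
par⇒%2 (suc zero)    = (λ ()) , λ _ → refl
par⇒%2 (suc (suc k)) rewrite Bool.not-involutive (par k) = par⇒%2 k

even⇒par : ∀ k → Even k → par k ≡ false
even⇒par k ev with par k in eq
... | false = refl
... | true  = ⊥-elim (0≢1+n (trans (sym ev) (par⇒%2 k .proj₂ eq)))

odd⇒par : ∀ k → Odd k → par k ≡ true
odd⇒par k od with par k in eq
... | true  = refl
... | false = ⊥-elim (0≢1+n (trans (sym (par⇒%2 k .proj₁ eq)) od))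

module Finite (N : ℕ) where

  toN : ℕ∞ → ℕ
  toN (fin k) = k
  toN ∞       = N

  toN-min : ∀ {P A k} → IsMin P A → P k → toN A ≤ k
  toN-min {A = fin _} (_ , least) Pk = least _ Pk
  toN-min {A = ∞}     none        Pk = ⊥-elim (none _ Pk)

  toN-attained : ∀ {P A} → IsMin P A → toN A < N → P (toN A)
  toN-attained {A = fin _} (Pk , _) _   = Pk
  toN-attained {A = ∞}     _        N<N = ⊥-elim (<-irrefl refl N<N)

  min∞-toN : ∀ A B → toN A ⊓ toN B < N → min∞ A B ≡ fin (toN A ⊓ toN B)
  min∞-toN (fin a) (fin b) _ = refl
  min∞-toN (fin a) ∞       h with a ≤? N
  ... | yes a≤N = cong fin (sym (m≤n⇒m⊓n≡m a≤N))
  -- A finite level above `N` would lose to the stand-in for `∞`; `h` rules this out.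
  ... | no  a≰N = ⊥-elim (<⇒≢ h (m≥n⇒m⊓n≡n (<⇒≤ (≰⇒> a≰N))))
  min∞-toN ∞ (fin b) h with b ≤? N
  ... | yes b≤N = cong fin (sym (m≥n⇒m⊓n≡n b≤N))
  ... | no  b≰N = ⊥-elim (<⇒≢ h (m≤n⇒m⊓n≡m (<⇒≤ (≰⇒> b≰N))))
  min∞-toN ∞ ∞ h = ⊥-elim (<⇒≢ h (⊓-idem N))

  +∞-toN : ∀ A B {t} → fin t ≡ A +∞ B +∞ fin 1 → suc (toN A + toN B) ≡ t
  +∞-toN (fin a) (fin b) refl = +-comm 1 (a + b)

  toN-+∞ : ∀ A B {t} → t < N → suc (toN A + toN B) ≡ t → fin t ≡ A +∞ B +∞ fin 1
  toN-+∞ (fin a) (fin b) _   eq = cong fin (trans (sym eq) (+-comm 1 (a + b)))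
  toN-+∞ (fin a) ∞       t<N eq = ⊥-elim (<⇒≱ t<N (≤-trans (≤-trans (m≤n+m N a) (n≤1+n _)) (≤-reflexive eq)))
  toN-+∞ ∞       B       t<N eq = ⊥-elim (<⇒≱ t<N (≤-trans (≤-trans (m≤m+n N (toN B)) (n≤1+n _)) (≤-reflexive eq)))

≤∞-min : ∀ {P A t k} → fin t ≤∞ A → IsMin P A → P k → t ≤ k
≤∞-min {A = fin _} t≤A (_ , least) Pk = ≤-trans t≤A (least _ Pk)
≤∞-min {A = ∞}     _   none        Pk = ⊥-elim (none _ Pk)

max∞-fin : ∀ A B {k} → fin k ≡ max∞ A B → ∃₂ λ a b → A ≡ fin a × B ≡ fin b × k ≡ a Nat.⊔ b
max∞-fin (fin a) (fin b) refl = a , b , refl , refl , refl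

-- Translation to and from the given graph

module Graph (G : MGraph) where

  open MGraph G

  Ed : Bool → V G → V G → Set
  Ed false u w = E u w × ¬ M u w
  Ed true  u w = E u w × M u w

  Ed-sym : ∀ {b u w} → Ed b u w → Ed b w u
  Ed-sym {false} (e , ¬m) = E-sym e , ¬m ∘ M-sym
  Ed-sym {true}  (e , m)  = E-sym e , M-sym m

  Ed-unique : ∀ {b c u w} → Ed b u w → Ed c u w → b ≡ c
  Ed-unique {false} {false} _ _ = refl
  Ed-unique {true}  {true}  _ _ = refl
  Ed-unique {false} {true}  (_ , ¬m) (_ , m) = ⊥-elim (¬m m)
  Ed-unique {true}  {false} (_ , m) (_ , ¬m) = ⊥-elim (¬m m)

  open Paths (V G) Fin._≟_ Ed Ed-sym (Unmatched G) public

  -- Indices beyond `k` are clamped to `k`, which makes the finite sequence total.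
  vertices : ∀ {k} → AltPath G k → ℕ → V G
  vertices {k} p i = vert p (fromℕ< (s≤s (m⊓n≤n i k)))

  vertices-toℕ : ∀ {k} (p : AltPath G k) (j : Fin (suc k)) {i} → toℕ j ≡ i → vertices p i ≡ vert p j
  vertices-toℕ p j refl = cong (vert p) (Fin.toℕ-injective
    (trans (Fin.toℕ-fromℕ< _) (m≤n⇒m⊓n≡m (≤-pred (Fin.toℕ<n j)))))

  fromAlt : ∀ {k} (p : AltPath G k) → Path (vertices p) k
  fromAlt {k} p = record { inj = inj′ ; free = start p ; step = step′ }
    where
    inj′ : ∀ {i j} → i ≤ k → j ≤ k → vertices p i ≡ vertices p j → i ≡ j
    inj′ i≤k j≤k e = trans (sym (m≤n⇒m⊓n≡m i≤k)) (trans (sym (Fin.toℕ-fromℕ< _))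
      (trans (cong toℕ (simple p _ _ e)) (trans (Fin.toℕ-fromℕ< _) (m≤n⇒m⊓n≡m j≤k))))
    Ed-at : ∀ (i : Fin k) → Ed (par (toℕ i)) (vert p (inject₁ i)) (vert p (suc i))
    Ed-at i with par (toℕ i) in eq
    ... | false = edge p i , alt-ev p i (par⇒%2 (toℕ i) .proj₁ eq)
    ... | true  = edge p i , alt-od p i (par⇒%2 (toℕ i) .proj₂ eq)
    step′ : ∀ {i} → i < k → Ed (par i) (vertices p i) (vertices p (suc i))
    step′ {i} i<k = subst₂ (Ed (par i))
      (sym (vertices-toℕ p (inject₁ j) (trans (Fin.toℕ-inject₁ j) (Fin.toℕ-fromℕ< i<k))))
      (sym (vertices-toℕ p (suc j) (cong suc (Fin.toℕ-fromℕ< i<k))))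
      (subst (λ l → Ed (par l) (vert p (inject₁ j)) (vert p (suc j))) (Fin.toℕ-fromℕ< i<k) (Ed-at j))
      where
      j : Fin k
      j = fromℕ< i<k

  toAlt : ∀ {p k} → Path p k → AltPath G k
  toAlt {p} {k} P = record
    { vert   = p ∘ toℕ
    ; simple = λ i j e → Fin.toℕ-injective (P .inj (≤-pred (Fin.toℕ<n i)) (≤-pred (Fin.toℕ<n j)) e)
    ; start  = P .free
    ; edge   = λ i → edge′ (par (toℕ i)) (Ed-at i)
    ; alt-ev = λ i ev → subst (λ b → Ed b (p (toℕ (inject₁ i))) (p (suc (toℕ i)))) (even⇒par (toℕ i) ev) (Ed-at i) .proj₂
    ; alt-od = λ i od → subst (λ b → Ed b (p (toℕ (inject₁ i))) (p (suc (toℕ i)))) (odd⇒par (toℕ i) od) (Ed-at i) .proj₂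
    }
    where
    Ed-at : ∀ (i : Fin k) → Ed (par (toℕ i)) (p (toℕ (inject₁ i))) (p (suc (toℕ i)))
    Ed-at i = subst (λ l → Ed (par (toℕ i)) (p l) (p (suc (toℕ i)))) (sym (Fin.toℕ-inject₁ i)) (P .step (Fin.toℕ<n i))
    edge′ : ∀ b {u w} → Ed b u w → E u w
    edge′ false = proj₁
    edge′ true  = proj₁

  endV-toAlt : ∀ {p k} (P : Path p k) → endV G (toAlt P) ≡ p k
  endV-toAlt {p} {k} P = cong p (Fin.toℕ-fromℕ k)

  endV-fromAlt : ∀ {k} (p : AltPath G k) → vertices p k ≡ endV G p
  endV-fromAlt {k} p = vertices-toℕ p (fromℕ k) (Fin.toℕ-fromℕ k)

  module Tenacity (L : Levels G) (t : ℕ) (t≤lm : fin t ≤∞ Levels.lm L) where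

    open Levels L
    open Finite (suc t)

    ℓ : Bool → V G → ℕ
    ℓ false v = toN (evenlevel v)
    ℓ true  v = toN (oddlevel v)

    ℓ-min : ∀ {p k} → Path p k → ℓ (par k) (p k) ≤ k
    ℓ-min {p} {k} P with par k in eq
    ... | false = toN-min (evenlevel-spec (p k)) (par⇒%2 k .proj₁ eq , toAlt P , endV-toAlt P)
    ... | true  = toN-min (oddlevel-spec (p k)) (par⇒%2 k .proj₂ eq , toAlt P , endV-toAlt P)

    ℓ-path : ∀ b v → ℓ b v < suc t → Σ (ℕ → V G) λ p → Path p (ℓ b v) × p (ℓ b v) ≡ v × par (ℓ b v) ≡ b
    ℓ-path false v h with toN-attained (evenlevel-spec v) h
    ... | ev , p , e = vertices p , fromAlt p , trans (endV-fromAlt p) e , even⇒par (ℓ false v) ev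
    ℓ-path true v h with toN-attained (oddlevel-spec v) h
    ... | od , p , e = vertices p , fromAlt p , trans (endV-fromAlt p) e , odd⇒par (ℓ true v) od

    -- An odd path to an unmatched vertex is augmenting, its ends being distinct by simplicity and
    -- odd length, so it is no shorter than `lm`. If there is none, the stand-in `suc t` exceeds
    -- `t`.
    free-high : ∀ {v} → Unmatched G v → t ≤ ℓ false v + ℓ true v
    free-high {v} fr = ≤-trans t≤odd (m≤n+m _ (ℓ false v))
      where
      t≤odd : t ≤ toN (oddlevel v)
      t≤odd with oddlevel v | oddlevel-spec v
      ... | ∞     | _ = n≤1+n t
      ... | fin k | (od , p , e) , _ = ≤∞-min t≤lm lm-spec (p , subst (Unmatched G) (sym e) fr , λ eq → distinct k od (simple p _ _ eq))
        where
        distinct : ∀ k → Odd k → Fin.zero ≢ fromℕ k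
        distinct zero () _
        distinct (suc k) _ ()

    open Levelled ℓ (suc t) t ≤-refl ℓ-min ℓ-path free-high public

    edge-tenacity⇒ : ∀ {b u w} → Ed b u w → EdgeTenacity G L u w (fin t) → suc (ℓ b u + ℓ b w) ≡ t
    edge-tenacity⇒ {false} {u} {w} (_ , ¬m) (f , _) = +∞-toN (evenlevel u) (evenlevel w) (f ¬m)
    edge-tenacity⇒ {true}  {u} {w} (_ , m)  (_ , f) = +∞-toN (oddlevel u) (oddlevel w) (f m)

    edge-tenacity⇐ : ∀ {b u w} → Ed b u w → suc (ℓ b u + ℓ b w) ≡ t → EdgeTenacity G L u w (fin t)
    edge-tenacity⇐ {false} {u} {w} (_ , ¬m) eq = (λ _ → toN-+∞ (evenlevel u) (evenlevel w) ≤-refl eq) , λ m → ⊥-elim (¬m m)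
    edge-tenacity⇐ {true}  {u} {w} (_ , m)  eq = (λ ¬m → ⊥-elim (¬m m)) , λ _ → toN-+∞ (oddlevel u) (oddlevel w) ≤-refl eq

    minlevel≡mn : ∀ {v} → mn v < suc t → minlevel G L v ≡ fin (mn v)
    minlevel≡mn {v} h = min∞-toN (evenlevel v) (oddlevel v) h

    fin-injective : ∀ {a b} → fin a ≡ fin b → a ≡ b
    fin-injective refl = refl

    -- Whether the edge is matched fixes the parity of `k`, so the prefix to `u` bounds `ℓ b u` by
    -- `k`; `edge-mn` gives the reverse inequality.
    last-of-min⇒ : ∀ {b u w} → Ed b u w → mn w < suc t → LastOfMinPath G L u w → suc (ℓ b u) ≡ mn w
    last-of-min⇒ {b} {u} {w} e mn<N (k , q , end≡ , pen≡ , k≡) = ≤-antisym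
      (subst (suc (ℓ b u) ≤_) sk≡ (s≤s ℓ≤k))
      (edge-mn e (≤-<-trans ℓ≤k (<-trans (≤-reflexive sk≡) mn<N)))
      where
      sk≡ : suc k ≡ mn w
      sk≡ = fin-injective (trans k≡ (minlevel≡mn mn<N))
      P : Path (vertices q) (suc k)
      P = fromAlt q
      at-u : vertices q k ≡ u
      at-u = trans (vertices-toℕ q (inject₁ (fromℕ k)) (trans (Fin.toℕ-inject₁ (fromℕ k)) (Fin.toℕ-fromℕ k))) pen≡
      par-k : par k ≡ b
      par-k = Ed-unique (subst₂ (Ed (par k)) at-u (trans (endV-fromAlt q) end≡) (P .step ≤-refl)) e
      ℓ≤k : ℓ b u ≤ k
      ℓ≤k = subst (_≤ k) (cong₂ ℓ par-k at-u) (on≤ P (n≤1+n k))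

    -- A shortest path to `u` of parity `b` is shorter than the minlevel of `w`, so it avoids `w`
    -- and can be extended by the edge.
    last-of-min⇐ : ∀ {b u w} → Ed b u w → mn w < suc t → suc (ℓ b u) ≡ mn w → LastOfMinPath G L u w
    last-of-min⇐ {b} {u} {w} e mn<N eq with level-path b u (<-trans (≤-reflexive eq) mn<N)
    ... | p , k , P , refl , refl , k≡ with on-path? p k w
    ...   | inj₁ (x , x≤k , refl) = ⊥-elim (<⇒≱ (≤-reflexive eq) (≤-trans (mn-on (P .path) x≤k) (≤-trans x≤k (≤-reflexive k≡))))
    ...   | inj₂ new = k , toAlt S , trans (endV-toAlt S) (trans (cong (snoc p k w) (+-comm 1 k)) (snoc-end p k w)) ,
              trans (cong (snoc p k w) (trans (Fin.toℕ-inject₁ (fromℕ k)) (Fin.toℕ-fromℕ k))) (snoc-≤ p k w ≤-refl) ,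
              trans (cong fin (trans (cong suc k≡) eq)) (sym (minlevel≡mn mn<N))
      where
      S : Path (snoc p k w) (suc k)
      S = subst (Path (snoc p k w)) (+-comm k 1) (snoc-path (P .path) e new)

    bridge-on-path : ∀ {k} (p : AltPath G k) → Lev (vertices p) k → T (vertices p k) ≡ t → off (vertices p) k < k →
      Σ (Fin k) λ i → BridgeOfTenacityAt G L p i (fin t) ×
        (∀ (j : Fin k) → BridgeOfTenacityAt G L p j (fin t) → j ≡ i)
    bridge-on-path {k} p Lp T≡ off<k with unique-bridge Lp T≡ off<k
    ... | c , c<k , ten , ¬prop , uniq = i ,
          ((edge p i , λ pr → ¬prop (subst (PropAt f) i≡ (Prop⇒ i pr))) , tenacity⇐ i (subst Ten (sym i≡) ten)) ,
          λ j B → Fin.toℕ-injective (trans (uniq (Fin.toℕ<n j) (tenacity⇒ j (B .proj₂)) (λ pr → B .proj₁ .proj₂ (Prop⇐ j pr))) (sym i≡))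
      where
      f : ℕ → V G
      f = vertices p
      i : Fin k
      i = fromℕ< c<k
      i≡ : toℕ i ≡ c
      i≡ = Fin.toℕ-fromℕ< c<k
      Ten : ℕ → Set
      Ten l = suc (on f l + off f (suc l)) ≡ t
      module At (j : Fin k) where
        l : ℕ
        l = toℕ j
        u w : V G
        u = vert p (inject₁ j)
        w = vert p (suc j)
        u≡ : f l ≡ u
        u≡ = vertices-toℕ p (inject₁ j) (Fin.toℕ-inject₁ j)
        w≡ : f (suc l) ≡ w
        w≡ = vertices-toℕ p (suc j) refl
        e : Ed (par l) u w
        e = subst₂ (Ed (par l)) u≡ w≡ (fromAlt p .step (Fin.toℕ<n j))
        on≡ : on f l ≡ ℓ (par l) u
        on≡ = cong (ℓ (par l)) u≡
        off≡ : off f (suc l) ≡ ℓ (par l) w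
        off≡ = cong₂ ℓ (Bool.not-involutive (par l)) w≡
        k≤t : k ≤ t
        k≤t = subst (k ≤_) (trans (sym (T-lev Lp)) T≡) (m≤m+n k _)
        mn-u : mn u < suc t
        mn-u = s≤s (≤-trans (subst (λ v → mn v ≤ l) u≡ (mn-on (fromAlt p) (<⇒≤ (Fin.toℕ<n j)))) (≤-trans (<⇒≤ (Fin.toℕ<n j)) k≤t))
        mn-w : mn w < suc t
        mn-w = s≤s (≤-trans (subst (λ v → mn v ≤ suc l) w≡ (mn-on (fromAlt p) (Fin.toℕ<n j))) (≤-trans (Fin.toℕ<n j) k≤t))
      tenacity⇒ : ∀ j → EdgeTenacity G L (vert p (inject₁ j)) (vert p (suc j)) (fin t) → Ten (toℕ j)
      tenacity⇒ j h = trans (cong suc (cong₂ _+_ on≡ off≡)) (edge-tenacity⇒ e h)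
        where open At j
      tenacity⇐ : ∀ j → Ten (toℕ j) → EdgeTenacity G L (vert p (inject₁ j)) (vert p (suc j)) (fin t)
      tenacity⇐ j h = edge-tenacity⇐ e (trans (sym (cong suc (cong₂ _+_ on≡ off≡))) h)
        where open At j
      Prop⇒ : ∀ j → Prop G L (vert p (inject₁ j)) (vert p (suc j)) → PropAt f (toℕ j)
      Prop⇒ j (inj₁ h) = inj₁ (trans (cong suc on≡) (trans (last-of-min⇒ e mn-w h) (cong mn (sym w≡))))
        where open At j
      Prop⇒ j (inj₂ h) = inj₂ (trans (cong suc off≡) (trans (last-of-min⇒ (Ed-sym e) mn-u h) (cong mn (sym u≡))))
        where open At j
      Prop⇐ : ∀ j → PropAt f (toℕ j) → Prop G L (vert p (inject₁ j)) (vert p (suc j))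
      Prop⇐ j (inj₁ h) = inj₁ (last-of-min⇐ e mn-w (trans (sym (cong suc on≡)) (trans h (cong mn w≡))))
        where open At j
      Prop⇐ j (inj₂ h) = inj₂ (last-of-min⇐ (Ed-sym e) mn-u (trans (sym (cong suc off≡)) (trans h (cong mn u≡))))
        where open At j

theorem6 : (G : MGraph) → ∃ (Unmatched G) → (L : Levels G) →
    (v : V G) (t : ℕ∞) → t ≡ tenacity G L v → t ≤∞ Levels.lm L →
    (k : ℕ) (p : AltPath G k) → endV G p ≡ v → fin k ≡ maxlevel G L v →
    Σ (Fin k) λ i → BridgeOfTenacityAt G L p i t ×
    (∀ (j : Fin k) → BridgeOfTenacityAt G L p j t → j ≡ i)
theorem6 G _ L v t t≡ t≤lm k p end≡ k≡
  with max∞-fin (Levels.evenlevel L v) (Levels.oddlevel L v) k≡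
-- A finite maxlevel makes both levels finite, so `t` is the number `a + b`.
... | a , b , ev≡ , od≡ , k≡a⊔b with trans t≡ (cong₂ _+∞_ ev≡ od≡)
... | refl = bridge-on-path p (fromAlt p , proj₁ split-levels) T≡ (proj₂ split-levels)
  where
  open Graph G
  open Tenacity L (a + b) t≤lm
  f : ℕ → V G
  f = vertices p
  fk≡ : f k ≡ v
  fk≡ = trans (endV-fromAlt p) end≡
  ℓ-even : ℓ false (f k) ≡ a
  ℓ-even = cong (Finite.toN (suc (a + b))) (trans (cong (Levels.evenlevel L) fk≡) ev≡)
  ℓ-odd : ℓ true (f k) ≡ b
  ℓ-odd = cong (Finite.toN (suc (a + b))) (trans (cong (Levels.oddlevel L) fk≡) od≡)
  T≡ : T (f k) ≡ a + b
  T≡ = cong₂ _+_ ℓ-even ℓ-odd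
  par-level : ∀ c {x} → ℓ c (f k) ≡ x → par x ≡ c
  par-level c refl = par-ℓ c (f k) (s≤s (≤-trans (ℓ≤T c (f k)) (≤-reflexive T≡)))
  -- The two levels differ in parity, so the maxlevel is strictly larger than the other one.
  a≢b : a ≢ b
  a≢b eq with trans (sym (par-level false ℓ-even)) (trans (cong par eq) (par-level true ℓ-odd))
  ... | ()
  levels-at : ∀ c → par k ≡ c → ℓ c (f k) ≡ k → ℓ (not c) (f k) < k → on f k ≡ k × off f k < k
  levels-at c refl x y = x , y
  split-levels : on f k ≡ k × off f k < k
  split-levels with ≤-total a b
  ... | inj₁ a≤b = levels-at true (par-level true ℓk≡) ℓk≡ (subst₂ _<_ (sym ℓ-even) (sym k≡b) (≤∧≢⇒< a≤b a≢b))
    where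
    k≡b : k ≡ b
    k≡b = trans k≡a⊔b (m≤n⇒m⊔n≡n a≤b)
    ℓk≡ : ℓ true (f k) ≡ k
    ℓk≡ = trans ℓ-odd (sym k≡b)
  ... | inj₂ b≤a = levels-at false (par-level false ℓk≡) ℓk≡ (subst₂ _<_ (sym ℓ-odd) (sym k≡a) (≤∧≢⇒< b≤a (a≢b ∘ sym)))
    where
    k≡a : k ≡ a
    k≡a = trans k≡a⊔b (m≥n⇒m⊔n≡m b≤a)
    ℓk≡ : ℓ false (f k) ≡ k
    ℓk≡ = trans ℓ-even (sym k≡a)
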